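{- Let $s$ and $n$ be positive integers. For each positive integer $m$ let $\lambda_m = (m, m-1, \ldots, 1)$. Then \[c_{s*\lambda_{2n-1},\, s*(n, n)}^{s*\lambda_{2n}} = \binom{2n}{sn}_s - \binom{2n}{sn+1}_s,\] where $c^{\lambda}_{\mu,\nu}$ denotes the Littlewood-Richardson coefficient, $s*\lambda$ denotes the partition obtained by multiplying every part of $\lambda$ by $s$, and $\binom{n}{k}_s$ denotes the $s$-binomial coefficient.
   Context: $s$-binomial coefficients: for positive integers $n, s$ and an integer $k$ with $0\le k\le sn$, $\binom{n}{k}_s$ is the coefficient of $x^k$ in $(1+x+x^2+\cdots+x^s)^n$. Stretching: for a partition $\lambda = (\lambda_1,\lambda_2,\ldots)$, $s*\lambda = (s\lambda_1, s\lambda_2, \ldots)$; e.g. $3*(3,2,1) = (9,6,3)$. Littlewood-Richardson coefficients: $c^{\lambda}_{\mu,\nu}$ is the multiplicity of $V^\lambda$ in $V^\mu\otimes V^\nu$, where $V^\mu, V^\nu, V^\lambda$ are irreducible polynomial representations of $GL(N)$ ($N$ at least the number of parts of each partition involved). Equivalently (Littlewood-Richardson rule), $c^{\lambda}_{\mu,\nu}$ is the number of semistandard fillings (weakly increasing along rows, strictly increasing down columns) of the skew shape $\lambda/\mu$ with content $\nu$ (exactly $\nu_i$ entries equal to $i$ for each $i$) such that the word obtained by reading the rows from top to bottom, each row from right to left, is a ballot word: in every initial segment, the number of $a$'s is at least the number of $b$'s whenever $a<b$. -}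

module Defs where

open import Data.Bool.Base using (if_then_else_)
open import Data.Fin as Fin using (Fin)
import Data.Fin.Properties as Fin
open import Data.List.Base
  using (List; []; _∷_; [_]; _++_; map; foldr; filter; length; lookup; reverse;
         replicate; upTo; applyDownFrom; zip; inits; concatMap;
         catMaybes; allFin; cartesianProductWith)
open import Data.List.Relation.Unary.All as All using (All; []; _∷_)
import Data.List.Relation.Unary.All.Properties as All
open import Data.List.Relation.Unary.Linked as Linked
  using (Linked; [-]; _∷_; linked?)
import Data.List.Relation.Unary.Linked.Properties as Linked
open import Data.Maybe.Base using (Maybe; just; nothing)
open import Data.Maybe.Relation.Binary.Connected using (Connected; connected?)
open import Data.Nat.Base
open import Data.Nat.ListAction using (sum)
open import Data.Nat.Properties
open import Data.Product.Base using (_×_; _,_; uncurry)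
open import Relation.Binary.PropositionalEquality.Core using (_≡_)
open import Relation.Nullary.Decidable using (Dec; does; _×-dec_; _→-dec_)

private variable
  A : Set
  ℓ : ℕ

-- Polynomials in x over ℕ, as sequences of coefficients; finite support is not
-- imposed, and the Cauchy product does not need it.

Poly : Set
Poly = ℕ → ℕ

infixl 7 _·_
infixr 8 _^ᵖ_

1ᵖ : Poly
1ᵖ zero    = 1
1ᵖ (suc _) = 0

_·_ : Poly → Poly → Poly
(p · q) k = sum (map (λ i → p i * q (k ∸ i)) (upTo (suc k)))

_^ᵖ_ : Poly → ℕ → Poly
p ^ᵖ zero  = 1ᵖ
p ^ᵖ suc n = p · p ^ᵖ n

-- 1 + x + ⋯ + xˢ
geometric : ℕ → Poly
geometric s k = if k ≤ᵇ s then 1 else 0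

binomial : (s n k : ℕ) → ℕ
binomial s n k = (geometric s ^ᵖ n) k

record Partition : Set where
  field
    parts      : List ℕ
    decreasing : Linked _≥_ parts
    positive   : All (0 <_) parts

open Partition public

infixr 7 _⋆_

_⋆_ : (s : ℕ) .{{_ : NonZero s}} → Partition → Partition
(s ⋆ α) .parts      = map (s *_) (α .parts)
(s ⋆ α) .decreasing = Linked.map⁺ (Linked.map (*-monoʳ-≤ s) (α .decreasing))
(s ⋆ α) .positive   =
  All.map⁺ (All.map (λ 0<a → *-mono-≤ (>-nonZero⁻¹ s) 0<a) (α .positive))

staircase : ℕ → Partition
staircase m .parts      = applyDownFrom suc m
staircase m .decreasing = Linked.applyDownFrom⁺₂ suc m (λ i → n≤1+n (suc i))
staircase m .positive   = All.applyDownFrom⁺₂ suc m (λ _ → z<s)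

twoRows : (n : ℕ) .{{_ : NonZero n}} → Partition
twoRows n .parts      = n ∷ n ∷ []
twoRows n .decreasing = ≤-refl ∷ [-]
twoRows n .positive   = >-nonZero⁻¹ n ∷ >-nonZero⁻¹ n ∷ []

-- The part of index i, counted from 0; it is 0 beyond the last part.
part : List ℕ → ℕ → ℕ
part []      _       = 0
part (a ∷ _) zero    = a
part (_ ∷ α) (suc i) = part α i

_⊆_ : Partition → Partition → Set
μ ⊆ κ = All (λ i → part (μ .parts) i ≤ part (κ .parts) i)
            (upTo (length (μ .parts)))

_⊆?_ : ∀ μ κ → Dec (μ ⊆ κ)
μ ⊆? κ = All.all? (λ i → part (μ .parts) i ≤? part (κ .parts) i) _

-- A filling of a skew shape κ/μ is given by the rows of the diagram of κ, with
-- nothing in the cells of μ.  The element i of Fin ℓ stands for the entry i + 1.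

Filling : ℕ → Set
Filling ℓ = List (List (Maybe (Fin ℓ)))

-- All ways to choose one element from each list in turn.
choices : List (List A) → List (List A)
choices = foldr (cartesianProductWith _∷_) [ [] ]

rowFillings : ∀ ℓ (m k : ℕ) → List (List (Maybe (Fin ℓ)))
rowFillings ℓ m k =
  choices (replicate m [ nothing ] ++ replicate (k ∸ m) (map just (allFin ℓ)))

-- All fillings of κ/μ, each listed once; there are none unless μ ⊆ κ.
fillings : ∀ ℓ (κ μ : Partition) → List (Filling ℓ)
fillings ℓ κ μ = if does (μ ⊆? κ) then choices rows else []
  where
  rows : List (List (List (Maybe (Fin ℓ))))
  rows = map (λ i → rowFillings ℓ (part (μ .parts) i) (part (κ .parts) i))
             (upTo (length (κ .parts)))

RowWeak : List (Maybe (Fin ℓ)) → Set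
RowWeak = Linked (Connected Fin._≤_)

-- zip discards the cells of the upper row that have no cell of κ below them.
ColumnStrict : (upper lower : List (Maybe (Fin ℓ))) → Set
ColumnStrict upper lower = All (uncurry (Connected Fin._<_)) (zip upper lower)

Semistandard : Filling ℓ → Set
Semistandard T = All RowWeak T × Linked ColumnStrict T

semistandard? : (T : Filling ℓ) → Dec (Semistandard T)
semistandard? T =
  All.all? (linked? (connected? Fin._≤?_)) T
  ×-dec
  linked? (λ u l → All.all? (λ (x , y) → connected? Fin._<?_ x y) (zip u l)) T

-- Rows from top to bottom, each from right to left.
readingWord : Filling ℓ → List (Fin ℓ)
readingWord = concatMap (λ row → reverse (catMaybes row))

occurrences : Fin ℓ → List (Fin ℓ) → ℕ
occurrences i w = length (filter (i Fin.≟_) w)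

HasContent : (ν : List ℕ) → List (Fin (length ν)) → Set
HasContent ν w = ∀ i → occurrences i w ≡ lookup ν i

hasContent? : ∀ ν w → Dec (HasContent ν w)
hasContent? ν w = Fin.all? (λ i → occurrences i w ≟ lookup ν i)

Ballot : List (Fin ℓ) → Set
Ballot w =
  All (λ u → ∀ a b → a Fin.< b → occurrences a u ≥ occurrences b u) (inits w)

ballot? : (w : List (Fin ℓ)) → Dec (Ballot w)
ballot? w = All.all?
  (λ u → Fin.all? λ a → Fin.all? λ b →
    (a Fin.<? b) →-dec (occurrences a u ≥? occurrences b u))
  (inits w)

IsLittlewoodRichardson : (ν : Partition) → Filling (length (ν .parts)) → Set
IsLittlewoodRichardson ν T =
  Semistandard T × HasContent (ν .parts) (readingWord T) × Ballot (readingWord T)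

isLittlewoodRichardson? : ∀ ν T → Dec (IsLittlewoodRichardson ν T)
isLittlewoodRichardson? ν T =
  semistandard? T
  ×-dec hasContent? (ν .parts) (readingWord T)
  ×-dec ballot? (readingWord T)

-- The coefficient with upper index κ and lower indices μ, ν.  Content ν leaves
-- no entry larger than the number of parts of ν, so the list below is exhaustive.
littlewoodRichardson : (κ μ ν : Partition) → ℕ
littlewoodRichardson κ μ ν =
  length (filter (isLittlewoodRichardson? ν) (fillings (length (ν .parts)) κ μ))

{-# OPTIONS --safe #-}
module Submission where

-- Each row of s * λ_{2n} / s * λ_{2n-1} has s cells, and no two of the rows share
-- a column.  So a Littlewood–Richardson filling is a choice, for each of the 2n
-- rows, of i ones and j twos with i + j = s, and the ballot condition says that
-- the excess d of ones over twos evolves by d ↦ d - j + i with j ≤ d, from 0 to 0.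
-- This is the Clebsch–Gordan rule for V_d ⊗ V_s, so the fillings are counted by
-- the multiplicity of V₀ in the 2n-th tensor power of V_s, which is a difference
-- of the multiplicities of the weights 0 and 2, that is, of s-binomial coefficients.

open import Defs
open import Data.Bool.Base using (Bool; true; false; _∧_; T; if_then_else_)
open import Data.Bool.Properties using (T?; ∧-zeroʳ)
open import Data.Fin as Fin using (Fin; zero; suc)
open import Data.Fin.Patterns using (0F; 1F)
open import Data.Integer as ℤ using (ℤ; +_; -[1+_]; _-_)
import Data.Integer.Properties as ℤ
import Data.Integer.Tactic.RingSolver as ℤ-solver
open import Data.List.Base
  using (List; []; _∷_; [_]; _++_; map; filter; length; reverse; replicate;
         applyUpTo; upTo; applyDownFrom; inits; concatMap; catMaybes; allFin;
         cartesianProductWith)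
open import Data.List.Properties
  using (map-++; map-∘; map-cong; map-id; map-upTo; ++-identityʳ;
         reverse-++; unfold-reverse; length-++; length-reverse;
         length-replicate; length-map)
open import Data.List.Relation.Unary.All as All using (All; []; _∷_)
import Data.List.Relation.Unary.All.Properties as All
open import Data.List.Relation.Unary.Linked as Linked using (Linked; []; [-]; _∷_; linked?)
open import Data.Maybe.Base using (Maybe; just; nothing)
open import Data.Maybe.Relation.Binary.Connected
  using (just; nothing; nothing-just)
open import Data.Nat using (ℕ; zero; suc; NonZero; _+_; _*_; _∸_; _≤_; ∣_-_∣; z≤n; s≤s; s≤s⁻¹)
open import Data.Nat.ListAction using (sum)
open import Data.Nat.ListAction.Properties using (sum-++)
open import Data.Nat.Properties
import Data.Nat.Tactic.RingSolver as ℕ-solver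
open import Data.Product.Base using (_×_; _,_; proj₁)
open import Data.Unit.Base using (tt)
open import Function.Base using (_∘_; id)
open import Function.Bundles using (_⇔_; mk⇔; Equivalence)
open import Relation.Binary.PropositionalEquality hiding ([_])
open import Relation.Nullary.Decidable using (Dec; does; dec-true; does-⇔; _×-dec_)
open import Relation.Unary using (Decidable)

private variable
  A B C : Set

-- Weight multiplicities and the Clebsch-Gordan recursion

antidiagonal : ℕ → (ℕ → ℕ → ℕ) → ℕ
antidiagonal zero    h = h 0 0
antidiagonal (suc s) h = h 0 (suc s) + antidiagonal s (h ∘ suc)

antidiagonal-cong : ∀ s {g h : ℕ → ℕ → ℕ} → (∀ i j → i + j ≡ s → g i j ≡ h i j) →
  antidiagonal s g ≡ antidiagonal s h
antidiagonal-cong zero    eq = eq 0 0 refl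
antidiagonal-cong (suc s) eq =
  cong₂ _+_ (eq 0 (suc s) refl) (antidiagonal-cong s λ i j p → eq (suc i) j (cong suc p))

antidiagonal-zero : ∀ s {h : ℕ → ℕ → ℕ} → (∀ i j → i + j ≡ s → h i j ≡ 0) →
  antidiagonal s h ≡ 0
antidiagonal-zero zero    eq = eq 0 0 refl
antidiagonal-zero (suc s) eq =
  cong₂ _+_ (eq 0 (suc s) refl) (antidiagonal-zero s λ i j p → eq (suc i) j (cong suc p))

-- The recursion splits off `i = 0`; `antidiagonal-flip` also needs the opposite end, `j = 0`.
antidiagonal-last : ∀ s (h : ℕ → ℕ → ℕ) →
  antidiagonal (suc s) h ≡ h (suc s) 0 + antidiagonal s (λ i j → h i (suc j))
antidiagonal-last zero    h = +-comm (h 0 1) (h 1 0)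
antidiagonal-last (suc s) h = begin
  h 0 (2 + s) + antidiagonal (suc s) (h ∘ suc)
    ≡⟨ cong (_+_ (h 0 (2 + s))) (antidiagonal-last s (h ∘ suc)) ⟩
  h 0 (2 + s) + (h (2 + s) 0 + antidiagonal s (λ i j → h (suc i) (suc j)))
    ≡⟨ swap (h 0 (2 + s)) (h (2 + s) 0) _ ⟩
  h (2 + s) 0 + antidiagonal (suc s) (λ i j → h i (suc j)) ∎
  where
  open ≡-Reasoning
  swap : ∀ a b c → a + (b + c) ≡ b + (a + c)
  swap = ℕ-solver.solve-∀

antidiagonal-flip : ∀ s (h : ℕ → ℕ → ℕ) →
  antidiagonal s h ≡ antidiagonal s (λ i j → h j i)
antidiagonal-flip zero    h = refl
antidiagonal-flip (suc s) h =
  trans (antidiagonal-last s h)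
        (cong (_+_ (h (suc s) 0)) (antidiagonal-flip s (λ i j → h i (suc j))))

-- This is `f (d ∸ j)` guarded by j ≤ d, with 0 otherwise. Lowering both numbers together mirrors
-- how `descends` consumes j letters `1F`.
after : ℕ → ℕ → (ℕ → ℕ) → ℕ
after zero    d       f = f d
after (suc j) zero    f = 0
after (suc j) (suc d) f = after j d f

after-cong : ∀ j d {f g : ℕ → ℕ} → (∀ e → f e ≡ g e) → after j d f ≡ after j d g
after-cong zero    d       eq = eq d
after-cong (suc j) zero    eq = refl
after-cong (suc j) (suc d) eq = after-cong j d eq

-- The multiplicity in V_s ^ ⊗ m of the weight d of SL₂.
weight : (s m : ℕ) → ℤ → ℕ
weight s zero    (+ 0) = 1
weight s zero    _     = 0
weight s (suc m) d     = antidiagonal s λ i j → weight s m (d ℤ.+ + i - + j)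

-- The multiplicity of V₀ in V_d ⊗ V_s ^ ⊗ m, by the Clebsch–Gordan rule
-- V_d ⊗ V_s = ⊕ V_{d - j + i}, over i + j = s with j ≤ d.
paths : (s m d : ℕ) → ℕ
paths s zero    zero    = 1
paths s zero    (suc d) = 0
paths s (suc m) d       = antidiagonal s λ i j → after j d λ e → paths s m (e + i)

-- Weyl group symmetry: exchanging i and j in every factor negates the total weight.
weight-neg : ∀ s m d → weight s m (ℤ.- d) ≡ weight s m d
weight-neg s zero    (+ 0)      = refl
weight-neg s zero    (+ suc _)  = refl
weight-neg s zero    (-[1+ _ ]) = refl
weight-neg s (suc m) d          = begin
  antidiagonal s (λ i j → weight s m (ℤ.- d ℤ.+ + i - + j))
    ≡⟨ antidiagonal-cong s (λ i j _ → cong (weight s m) (negate d (+ i) (+ j))) ⟩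
  antidiagonal s (λ i j → weight s m (ℤ.- (d ℤ.+ + j - + i)))
    ≡⟨ antidiagonal-cong s (λ i j _ → weight-neg s m (d ℤ.+ + j - + i)) ⟩
  antidiagonal s (λ i j → weight s m (d ℤ.+ + j - + i))
    ≡⟨ antidiagonal-flip s _ ⟨
  antidiagonal s (λ i j → weight s m (d ℤ.+ + i - + j)) ∎
  where
  open ≡-Reasoning
  negate : ∀ d i j → ℤ.- d ℤ.+ i - j ≡ ℤ.- (d ℤ.+ j - i)
  negate = ℤ-solver.solve-∀

weight-distance : ∀ s m a b → weight s m (+ a - + b) ≡ weight s m (+ ∣ a - b ∣)
weight-distance s m a       zero    =
  cong (weight s m) (trans (ℤ.+-identityʳ (+ a)) (cong +_ (sym (∣-∣-identityʳ a))))
weight-distance s m zero    (suc b) =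
  weight-neg s m (+ suc b)
weight-distance s m (suc a) (suc b) =
  trans (cong (weight s m) (cancel (+ a) (+ b))) (weight-distance s m a b)
  where
  cancel : ∀ a b → (+ 1 ℤ.+ a) - (+ 1 ℤ.+ b) ≡ a - b
  cancel = ℤ-solver.solve-∀

-- The two sums run in steps of 2 over d - s, ..., d + s and over d - s + 2, ..., d + s + 2, so they
-- differ only in their extreme terms.
weight-telescope : ∀ s (w : ℤ → ℕ) d →
  antidiagonal s (λ i j → w (d ℤ.+ + i - + j)) + w (d ℤ.+ + s ℤ.+ + 2)
    ≡ w (d - + s) + antidiagonal s (λ i j → w (d ℤ.+ + 2 ℤ.+ + i - + j))
weight-telescope zero w d = cong₂ _+_ (cong w (e₁ d)) (cong w (e₂ d))
  where
  e₁ : ∀ d → d ℤ.+ + 0 - + 0 ≡ d - + 0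
  e₁ = ℤ-solver.solve-∀
  e₂ : ∀ d → d ℤ.+ + 0 ℤ.+ + 2 ≡ d ℤ.+ + 2 ℤ.+ + 0 - + 0
  e₂ = ℤ-solver.solve-∀
weight-telescope (suc s) w d = begin
  w (d ℤ.+ + 0 - + suc s) + antidiagonal s (λ i j → w (d ℤ.+ + suc i - + j)) + w (d ℤ.+ + suc s ℤ.+ + 2)
    ≡⟨ cong₂ _+_ (cong₂ _+_ (cong w (e₁ d (+ s))) (antidiagonal-cong s λ i j _ → cong w (e₂ d (+ i) (+ j))))
                 (cong w (e₃ d (+ s))) ⟩
  w (d - + suc s) + antidiagonal s (λ i j → w (d ℤ.+ + 1 ℤ.+ + i - + j)) + w (d ℤ.+ + 1 ℤ.+ + s ℤ.+ + 2)
    ≡⟨ +-assoc (w (d - + suc s)) _ _ ⟩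
  w (d - + suc s) + (antidiagonal s (λ i j → w (d ℤ.+ + 1 ℤ.+ + i - + j)) + w (d ℤ.+ + 1 ℤ.+ + s ℤ.+ + 2))
    -- Once `i = 0` is split off, the unit taken from i moves the centre from d to d + 1.
    ≡⟨ cong (_+_ (w (d - + suc s))) (weight-telescope s w (d ℤ.+ + 1)) ⟩
  w (d - + suc s) + (w (d ℤ.+ + 1 - + s) + antidiagonal s (λ i j → w (d ℤ.+ + 1 ℤ.+ + 2 ℤ.+ + i - + j)))
    ≡⟨ cong (_+_ (w (d - + suc s))) (cong₂ _+_ (cong w (e₄ d (+ s)))
         (antidiagonal-cong s λ i j _ → cong w (e₅ d (+ i) (+ j)))) ⟩
  w (d - + suc s) + antidiagonal (suc s) (λ i j → w (d ℤ.+ + 2 ℤ.+ + i - + j)) ∎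
  where
  open ≡-Reasoning
  e₁ : ∀ d s → d ℤ.+ + 0 - (+ 1 ℤ.+ s) ≡ d - (+ 1 ℤ.+ s)
  e₁ = ℤ-solver.solve-∀
  e₂ : ∀ d i j → d ℤ.+ (+ 1 ℤ.+ i) - j ≡ d ℤ.+ + 1 ℤ.+ i - j
  e₂ = ℤ-solver.solve-∀
  e₃ : ∀ d s → d ℤ.+ (+ 1 ℤ.+ s) ℤ.+ + 2 ≡ d ℤ.+ + 1 ℤ.+ s ℤ.+ + 2
  e₃ = ℤ-solver.solve-∀
  e₄ : ∀ d s → d ℤ.+ + 1 - s ≡ d ℤ.+ + 2 ℤ.+ + 0 - (+ 1 ℤ.+ s)
  e₄ = ℤ-solver.solve-∀
  e₅ : ∀ d i j → d ℤ.+ + 1 ℤ.+ + 2 ℤ.+ i - j ≡ d ℤ.+ + 2 ℤ.+ (+ 1 ℤ.+ i) - j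
  e₅ = ℤ-solver.solve-∀

-- The hypothesis says f d = w d - w (d + 2): the multiplicity of V_d as a difference of weight
-- multiplicities. It will be the induction hypothesis of `paths-weight`.
module _ (f w : ℕ → ℕ) (f+w : ∀ d → f d + w (2 + d) ≡ w d) where

  -- If d > s, the guard passes and the hypothesis on f and w applies at d - s - 1 + c. If d ≤ s,
  -- the first term is 0 and the two arguments of w agree, because ∣ d - (s + 1) ∣ = ∣ d - s ∣ + 1.
  after-telescope : ∀ s d c →
    after (suc s) d (λ e → f (e + c)) + w (∣ d - s ∣ + suc c) ≡ w (∣ d - suc s ∣ + c)
  after-telescope zero    zero    c = refl
  after-telescope zero    (suc d) c rewrite ∣-∣-identityʳ d | +-suc d c = f+w (d + c)
  after-telescope (suc s) zero    c = cong (w ∘ suc) (+-suc s c)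
  after-telescope (suc s) (suc d) c = after-telescope s d c

  -- The indices d - j + i with j ≤ d run in steps of 2 from ∣ d - s ∣ to d + s, as in V_d ⊗ V_s, so
  -- the differences f = w - w (2 + _) telescope. The offset c absorbs the shift of i in the
  -- induction on s.
  paths-telescope : ∀ s d c →
    antidiagonal s (λ i j → after j d λ e → f (e + i + c)) + w (d + s + c + 2)
      ≡ w (∣ d - s ∣ + c)
  paths-telescope zero d c
    rewrite +-identityʳ d | ∣-∣-identityʳ d | +-comm (d + c) 2 = f+w (d + c)
  paths-telescope (suc s) d c = begin
    after (suc s) d (λ e → f (e + 0 + c)) + antidiagonal s (λ i j → after j d λ e → f (e + suc i + c))
      + w (d + suc s + c + 2)
      ≡⟨ cong₂ _+_ (cong₂ _+_
           (after-cong (suc s) d λ e → cong (λ x → f (x + c)) (+-identityʳ e))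
           (antidiagonal-cong s λ i j _ → after-cong j d λ e → cong f (e₁ e i c)))
           (cong w (e₂ d s c)) ⟩
    after (suc s) d (λ e → f (e + c)) + antidiagonal s (λ i j → after j d λ e → f (e + i + suc c))
      + w (d + s + suc c + 2)
      ≡⟨ +-assoc (after (suc s) d (λ e → f (e + c))) _ _ ⟩
    after (suc s) d (λ e → f (e + c)) + (antidiagonal s (λ i j → after j d λ e → f (e + i + suc c))
      + w (d + s + suc c + 2))
      ≡⟨ cong (_+_ (after (suc s) d (λ e → f (e + c)))) (paths-telescope s d (suc c)) ⟩
    after (suc s) d (λ e → f (e + c)) + w (∣ d - s ∣ + suc c)
      ≡⟨ after-telescope s d c ⟩
    w (∣ d - suc s ∣ + c) ∎
    where
    open ≡-Reasoning
    e₁ : ∀ e i c → e + suc i + c ≡ e + i + suc c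
    e₁ = ℕ-solver.solve-∀
    e₂ : ∀ d s c → d + suc s + c + 2 ≡ d + s + suc c + 2
    e₂ = ℕ-solver.solve-∀

-- V_d is self-dual, so `paths s m d` is also the multiplicity of V_d in the m-th tensor power, that
-- is, the multiplicity of the weight d minus that of d + 2. In the induction both sides telescope
-- to the same two end terms, up to the reflection of d - s.
paths-weight : ∀ s m d → paths s m d + weight s m (+ (2 + d)) ≡ weight s m (+ d)
paths-weight s zero    zero    = refl
paths-weight s zero    (suc d) = refl
-- The added term is the upper end of both telescoping sums; adding it avoids subtraction in ℕ.
paths-weight s (suc m) d       = +-cancelʳ-≡ (w (+ (d + s + 2))) _ _ (begin
  paths s (suc m) d + W (+ (2 + d)) + w (+ (d + s + 2))
    ≡⟨ swap (paths s (suc m) d) _ _ ⟩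
  paths s (suc m) d + w (+ (d + s + 2)) + W (+ (2 + d))
    ≡⟨ cong₂ _+_ telescoped (cong (λ x → W (+ x)) (+-comm 2 d)) ⟩
  w (+ ∣ d - s ∣) + W (+ (d + 2))
    ≡⟨ cong (_+ W (+ (d + 2))) (weight-distance s m d s) ⟨
  w (+ d - + s) + W (+ (d + 2))
    ≡⟨ weight-telescope s w (+ d) ⟨
  W (+ d) + w (+ (d + s + 2)) ∎)
  where
  open ≡-Reasoning
  w = weight s m
  W = weight s (suc m)
  swap : ∀ a b c → a + b + c ≡ a + c + b
  swap = ℕ-solver.solve-∀
  telescoped : paths s (suc m) d + w (+ (d + s + 2)) ≡ w (+ ∣ d - s ∣)
  telescoped = begin
    paths s (suc m) d + w (+ (d + s + 2))
      ≡⟨ cong₂ _+_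
           (antidiagonal-cong s λ i j _ → after-cong j d λ e → cong (paths s m) (sym (+-identityʳ (e + i))))
           (cong (λ x → w (+ (x + 2))) (sym (+-identityʳ (d + s)))) ⟩
    antidiagonal s (λ i j → after j d λ e → paths s m (e + i + 0)) + w (+ (d + s + 0 + 2))
      ≡⟨ paths-telescope (paths s m) (λ x → w (+ x)) (paths-weight s m) s d 0 ⟩
    w (+ (∣ d - s ∣ + 0))
      ≡⟨ cong (λ x → w (+ x)) (+-identityʳ ∣ d - s ∣) ⟩
    w (+ ∣ d - s ∣) ∎

-- Weight multiplicities as s-binomial coefficients

applyUpTo-cong : ∀ {f g : ℕ → A} → (∀ i → f i ≡ g i) → ∀ n → applyUpTo f n ≡ applyUpTo g n
applyUpTo-cong eq zero    = refl
applyUpTo-cong eq (suc n) = cong₂ _∷_ (eq 0) (applyUpTo-cong (eq ∘ suc) n)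

sum-applyUpTo-0 : ∀ n → sum (applyUpTo (λ _ → 0) n) ≡ 0
sum-applyUpTo-0 zero    = refl
sum-applyUpTo-0 (suc n) = sum-applyUpTo-0 n

geometric-suc : ∀ s i → geometric (suc s) (suc i) ≡ geometric s i
geometric-suc s zero    = refl
geometric-suc s (suc i) = refl

-- The Cauchy product runs over i ≤ k, the antidiagonal over i ≤ s. Terms with i > s vanish through
-- `geometric`, and those with i > k through g, the extension of p to ℤ by zero.
geometric-· : ∀ s k (p : Poly) (g : ℤ → ℕ) → (∀ k → g (+ k) ≡ p k) → (∀ k → g -[1+ k ] ≡ 0) →
  (geometric s · p) k ≡ antidiagonal s (λ i j → g (+ k - + i))
geometric-· s k p g g-pos g-neg =
  trans (cong sum (map-upTo (λ i → geometric s i * p (k ∸ i)) (suc k))) (go s k)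
  where
  open ≡-Reasoning
  cancel : ∀ k i → k - i ≡ (+ 1 ℤ.+ k) - (+ 1 ℤ.+ i)
  cancel = ℤ-solver.solve-∀
  go : ∀ s k → sum (applyUpTo (λ i → geometric s i * p (k ∸ i)) (suc k))
               ≡ antidiagonal s (λ i j → g (+ k - + i))
  go zero k = begin
    p k + 0 + sum (applyUpTo (λ _ → 0) k) ≡⟨ cong₂ _+_ (+-identityʳ (p k)) (sum-applyUpTo-0 k) ⟩
    p k + 0                               ≡⟨ +-identityʳ (p k) ⟩
    p k                                   ≡⟨ g-pos k ⟨
    g (+ k)                               ≡⟨ cong g (ℤ.+-identityʳ (+ k)) ⟨
    g (+ k - + 0)                         ∎
  go (suc s) zero = begin
    p 0 + 0 + 0
      ≡⟨ +-identityʳ (p 0 + 0) ⟩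
    p 0 + 0
      ≡⟨ cong₂ _+_ (g-pos 0) (antidiagonal-zero s λ i j _ → g-neg i) ⟨
    g (+ 0) + antidiagonal s (λ i j → g -[1+ i ]) ∎
  go (suc s) (suc k) = begin
    p (suc k) + 0 + sum (applyUpTo (λ i → geometric (suc s) (suc i) * p (k ∸ i)) (suc k))
      ≡⟨ cong₂ _+_ (trans (+-identityʳ (p (suc k))) (sym (g-pos (suc k))))
           (cong sum (applyUpTo-cong (λ i → cong (_* p (k ∸ i)) (geometric-suc s i)) (suc k))) ⟩
    g (+ suc k) + sum (applyUpTo (λ i → geometric s i * p (k ∸ i)) (suc k))
      ≡⟨ cong₂ _+_ (cong g (sym (ℤ.+-identityʳ (+ suc k)))) (trans (go s k)
           (antidiagonal-cong s λ i j _ → cong g (cancel (+ k) (+ i)))) ⟩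
    g (+ suc k - + 0) + antidiagonal s (λ i j → g (+ suc k - + suc i)) ∎

-- The lowest weight of the m-th tensor power is -sm. Removing a factor with i + j = s leaves the
-- argument below the new bound, by 2j more than before; hence `t + (j + j)`.
weight-vanishes : ∀ s m t → weight s m (ℤ.- + suc t - + s ℤ.* + m) ≡ 0
weight-vanishes s zero    t = cong (weight s 0) (arg (+ suc t) (+ s))
  where
  arg : ∀ t s → ℤ.- t - s ℤ.* + 0 ≡ ℤ.- t
  arg = ℤ-solver.solve-∀
weight-vanishes s (suc m) t = antidiagonal-zero s λ i j p →
  trans (cong (weight s m) (arg (+ t) (+ i) (+ j) (+ m) (cong +_ p))) (weight-vanishes s m (t + (j + j)))
  where
  ring : ∀ t i j m →
    ℤ.- (+ 1 ℤ.+ t) - (i ℤ.+ j) ℤ.* (+ 1 ℤ.+ m) ℤ.+ i - j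
      ≡ ℤ.- (+ 1 ℤ.+ (t ℤ.+ (j ℤ.+ j))) - (i ℤ.+ j) ℤ.* m
  ring = ℤ-solver.solve-∀
  arg : ∀ t i j m {s} → i ℤ.+ j ≡ s →
    ℤ.- (+ 1 ℤ.+ t) - s ℤ.* (+ 1 ℤ.+ m) ℤ.+ i - j
      ≡ ℤ.- (+ 1 ℤ.+ (t ℤ.+ (j ℤ.+ j))) - s ℤ.* m
  arg t i j m refl = ring t i j m

-- The monomial of degree i in one factor 1 + x + ⋯ + xˢ stands for the weight 2i - s of V_s, so
-- degree k in m factors stands for the weight 2k - sm.
binomial-weight : ∀ s m k → binomial s m k ≡ weight s m (+ 2 ℤ.* + k - + s ℤ.* + m)
binomial-weight s zero k =
  trans (constant k) (cong (weight s 0) (arg (+ k) (+ s)))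
  where
  arg : ∀ k s → k ℤ.+ k ≡ + 2 ℤ.* k - s ℤ.* + 0
  arg = ℤ-solver.solve-∀
  constant : ∀ k → 1ᵖ k ≡ weight s 0 (+ (k + k))
  constant zero    = refl
  constant (suc k) = refl
binomial-weight s (suc m) k = begin
  binomial s (suc m) k
    ≡⟨ geometric-· s k (geometric s ^ᵖ m) g (λ l → sym (binomial-weight s m l)) g-neg ⟩
  antidiagonal s (λ i j → g (+ k - + i))
    ≡⟨ antidiagonal-cong s (λ i j p → cong (weight s m) (arg (+ k) (+ i) (+ j) (+ m) (cong +_ p))) ⟩
  antidiagonal s (λ i j → weight s m (+ 2 ℤ.* + k - + s ℤ.* + suc m ℤ.+ + j - + i))
    -- Removing degree i changes the argument by j - i, whereas `weight` changes it by i - j.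
    ≡⟨ antidiagonal-flip s _ ⟨
  weight s (suc m) (+ 2 ℤ.* + k - + s ℤ.* + suc m) ∎
  where
  open ≡-Reasoning
  g : ℤ → ℕ
  g x = weight s m (+ 2 ℤ.* x - + s ℤ.* + m)
  g-neg : ∀ l → g -[1+ l ] ≡ 0
  -- `2 * suc l` computes to `suc (l + suc (l + 0))`, which gives the witness.
  g-neg l = weight-vanishes s m (l + suc (l + 0))
  ring : ∀ k i j m →
    + 2 ℤ.* (k - i) - (i ℤ.+ j) ℤ.* m ≡ + 2 ℤ.* k - (i ℤ.+ j) ℤ.* (+ 1 ℤ.+ m) ℤ.+ j - i
  ring = ℤ-solver.solve-∀
  arg : ∀ k i j m {s} → i ℤ.+ j ≡ s →
    + 2 ℤ.* (k - i) - s ℤ.* m ≡ + 2 ℤ.* k - s ℤ.* (+ 1 ℤ.+ m) ℤ.+ j - i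
  arg k i j m refl = ring k i j m

-- For m = 2n the degrees sn and sn + 1 correspond to the weights 0 and 2.
paths-binomial : ∀ s n →
  paths s (2 * n) 0 + binomial s (2 * n) (s * n + 1) ≡ binomial s (2 * n) (s * n)
paths-binomial s n = begin
  paths s (2 * n) 0 + binomial s (2 * n) (s * n + 1)
    ≡⟨ cong (_+_ (paths s (2 * n) 0)) (binomial-central 1) ⟩
  paths s (2 * n) 0 + weight s (2 * n) (+ 2)
    ≡⟨ paths-weight s (2 * n) 0 ⟩
  weight s (2 * n) (+ 0)
    ≡⟨ binomial-central 0 ⟨
  binomial s (2 * n) (s * n + 0)
    ≡⟨ cong (binomial s (2 * n)) (+-identityʳ (s * n)) ⟩
  binomial s (2 * n) (s * n) ∎
  where
  open ≡-Reasoning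
  ring : ∀ s n k → + 2 ℤ.* (s ℤ.* n ℤ.+ k) - s ℤ.* (+ 2 ℤ.* n) ≡ + 2 ℤ.* k
  ring = ℤ-solver.solve-∀
  arg : ∀ k → + 2 ℤ.* + (s * n + k) - + s ℤ.* + (2 * n) ≡ + (2 * k)
  arg k = begin
    + 2 ℤ.* + (s * n + k) - + s ℤ.* + (2 * n)
      ≡⟨ cong₂ (λ x y → + 2 ℤ.* (x ℤ.+ + k) - + s ℤ.* y) (ℤ.pos-* s n) (ℤ.pos-* 2 n) ⟩
    + 2 ℤ.* (+ s ℤ.* + n ℤ.+ + k) - + s ℤ.* (+ 2 ℤ.* + n)
      ≡⟨ ring (+ s) (+ n) (+ k) ⟩
    + 2 ℤ.* + k
      ≡⟨ ℤ.pos-* 2 k ⟨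
    + (2 * k) ∎
  binomial-central : ∀ k → binomial s (2 * n) (s * n + k) ≡ weight s (2 * n) (+ (2 * k))
  binomial-central k = trans (binomial-weight s (2 * n) (s * n + k)) (cong (weight s (2 * n)) (arg k))

-- Sums over lists

χ : Bool → ℕ
χ b = if b then 1 else 0

∑ : List A → (A → ℕ) → ℕ
∑ xs f = sum (map f xs)

∑-++ : ∀ (xs ys : List A) f → ∑ (xs ++ ys) f ≡ ∑ xs f + ∑ ys f
∑-++ xs ys f = trans (cong sum (map-++ f xs ys)) (sum-++ (map f xs) (map f ys))

∑-map : ∀ (g : A → B) xs f → ∑ (map g xs) f ≡ ∑ xs (f ∘ g)
∑-map g xs f = cong sum (sym (map-∘ xs))

∑-cong : ∀ (xs : List A) {f g : A → ℕ} → (∀ x → f x ≡ g x) → ∑ xs f ≡ ∑ xs g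
∑-cong xs eq = cong sum (map-cong eq xs)

∑-cong-All : ∀ {xs : List A} {f g : A → ℕ} → All (λ x → f x ≡ g x) xs → ∑ xs f ≡ ∑ xs g
∑-cong-All []         = refl
∑-cong-All (eq ∷ eqs) = cong₂ _+_ eq (∑-cong-All eqs)

∑-zero : ∀ (xs : List A) {f : A → ℕ} → (∀ x → f x ≡ 0) → ∑ xs f ≡ 0
∑-zero []       eq = refl
∑-zero (x ∷ xs) eq = cong₂ _+_ (eq x) (∑-zero xs eq)

∑-*ˡ : ∀ c (xs : List A) f → ∑ xs (λ x → c * f x) ≡ c * ∑ xs f
∑-*ˡ c []       f = sym (*-zeroʳ c)
∑-*ˡ c (x ∷ xs) f =
  trans (cong (_+_ (c * f x)) (∑-*ˡ c xs f)) (sym (*-distribˡ-+ c (f x) (∑ xs f)))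

∑-cartesianProductWith : ∀ (g : A → B → C) xs ys f →
  ∑ (cartesianProductWith g xs ys) f ≡ ∑ xs (λ x → ∑ ys (f ∘ g x))
∑-cartesianProductWith g []       ys f = refl
∑-cartesianProductWith g (x ∷ xs) ys f =
  trans (∑-++ (map (g x) ys) _ f)
        (cong₂ _+_ (∑-map (g x) ys f) (∑-cartesianProductWith g xs ys f))

length-filter-∑ : ∀ {P : A → Set} (P? : Decidable P) xs →
  length (filter P? xs) ≡ ∑ xs (λ x → χ (does (P? x)))
length-filter-∑ P? []       = refl
length-filter-∑ P? (x ∷ xs) with does (P? x)
... | true  = cong suc (length-filter-∑ P? xs)
... | false = length-filter-∑ P? xs

cartesianProductWith-All : ∀ {P : A → Set} {Q : B → Set} {R : C → Set} (g : A → B → C) →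
  (∀ {x y} → P x → Q y → R (g x y)) →
  ∀ {xs ys} → All P xs → All Q ys → All R (cartesianProductWith g xs ys)
cartesianProductWith-All g r []         qs = []
cartesianProductWith-All g r (px ∷ pxs) qs =
  All.++⁺ (All.map⁺ (All.map (r px) qs)) (cartesianProductWith-All g r pxs qs)

cartesianProductWith-map : ∀ {A′ B′ C′ : Set} {g : A → B → C} {g′ : A′ → B′ → C′}
  {a : A → A′} {b : B → B′} {c : C → C′} → (∀ x y → g′ (a x) (b y) ≡ c (g x y)) →
  ∀ xs ys → cartesianProductWith g′ (map a xs) (map b ys) ≡ map c (cartesianProductWith g xs ys)
cartesianProductWith-map eq []       ys = refl
cartesianProductWith-map {g = g} {g′} {a} {b} {c} eq (x ∷ xs) ys = begin
  map (g′ (a x)) (map b ys) ++ cartesianProductWith g′ (map a xs) (map b ys)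
    ≡⟨ cong₂ _++_ (trans (sym (map-∘ ys)) (trans (map-cong (eq x) ys) (map-∘ ys)))
                  (cartesianProductWith-map eq xs ys) ⟩
  map c (map (g x) ys) ++ map c (cartesianProductWith g xs ys)
    ≡⟨ map-++ c (map (g x) ys) _ ⟨
  map c (cartesianProductWith g (x ∷ xs) ys) ∎
  where open ≡-Reasoning

choices-All : ∀ {P : A → Set} {xs} → All P xs → ∀ n →
  All (λ ys → length ys ≡ n × All P ys) (choices (replicate n xs))
choices-All pxs zero    = (refl , []) ∷ []
choices-All pxs (suc n) =
  cartesianProductWith-All _∷_ (λ px (eq , pys) → cong suc eq , px ∷ pys) pxs (choices-All pxs n)

choices-map : ∀ (g : A → B) xs n →
  choices (replicate n (map g xs)) ≡ map (map g) (choices (replicate n xs))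
choices-map g xs zero    = refl
choices-map g xs (suc n) =
  trans (cong (cartesianProductWith _∷_ (map g xs)) (choices-map g xs n))
        (cartesianProductWith-map (λ _ _ → refl) xs (choices (replicate n xs)))

choices-prefix : ∀ (x : A) m xss →
  choices (replicate m [ x ] ++ xss) ≡ map (replicate m x ++_) (choices xss)
choices-prefix x zero    xss = sym (map-id (choices xss))
choices-prefix x (suc m) xss = begin
  map (x ∷_) (choices (replicate m [ x ] ++ xss)) ++ []
    ≡⟨ ++-identityʳ _ ⟩
  map (x ∷_) (choices (replicate m [ x ] ++ xss))
    ≡⟨ cong (map (x ∷_)) (choices-prefix x m xss) ⟩
  map (x ∷_) (map (replicate m x ++_) (choices xss))
    ≡⟨ map-∘ (choices xss) ⟨
  map (replicate (suc m) x ++_) (choices xss) ∎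
  where open ≡-Reasoning

-- Words in two letters

Word : Set
Word = List (Fin 2)

words : ℕ → List Word
words s = choices (replicate s (allFin 2))

weak? : (u : Word) → Dec (Linked Fin._≤_ u)
weak? = linked? Fin._≤?_

∑-words-suc : ∀ s (f : Word → ℕ) → ∑ (words (suc s)) f ≡ ∑ (words s) (f ∘ (0F ∷_)) + ∑ (words s) (f ∘ (1F ∷_))
∑-words-suc s f = trans (∑-cartesianProductWith _∷_ (allFin 2) (words s) f)
  (cong (_+_ (∑ (words s) (f ∘ (0F ∷_)))) (+-identityʳ _))

-- In a weakly increasing word only `1F` can follow `1F`, so a single word survives.
∑-weak-after-1 : ∀ s (h : Word → ℕ) →
  ∑ (words s) (λ u → χ (does (weak? (1F ∷ u))) * h u) ≡ h (replicate s 1F)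
∑-weak-after-1 zero    h = trans (+-identityʳ _) (+-identityʳ (h []))
∑-weak-after-1 (suc s) h = begin
  ∑ (words (suc s)) (λ u → χ (does (weak? (1F ∷ u))) * h u)
    ≡⟨ ∑-words-suc s _ ⟩
  ∑ (words s) (λ _ → 0) + ∑ (words s) (λ u → χ (does (weak? (1F ∷ u))) * h (1F ∷ u))
    ≡⟨ cong₂ _+_ (∑-zero (words s) (λ _ → refl)) (∑-weak-after-1 s (h ∘ (1F ∷_))) ⟩
  h (replicate (suc s) 1F) ∎
  where open ≡-Reasoning

weak-0∷ : ∀ u → does (weak? (0F ∷ u)) ≡ does (weak? u)
weak-0∷ []      = refl
weak-0∷ (_ ∷ _) = refl

-- A weakly increasing word is i zeros followed by j ones. Those starting with `1F` give the term
-- `i = 0`, the others come from the induction.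
∑-weak : ∀ s (h : Word → ℕ) →
  ∑ (words s) (λ u → χ (does (weak? u)) * h u)
    ≡ antidiagonal s (λ i j → h (replicate i 0F ++ replicate j 1F))
∑-weak zero    h = trans (+-identityʳ _) (+-identityʳ (h []))
∑-weak (suc s) h = begin
  ∑ (words (suc s)) (λ u → χ (does (weak? u)) * h u)
    ≡⟨ ∑-words-suc s _ ⟩
  ∑ (words s) (λ u → χ (does (weak? (0F ∷ u))) * h (0F ∷ u))
    + ∑ (words s) (λ u → χ (does (weak? (1F ∷ u))) * h (1F ∷ u))
    ≡⟨ cong₂ _+_ (trans (∑-cong (words s) (λ u → cong (λ b → χ b * h (0F ∷ u)) (weak-0∷ u)))
                        (∑-weak s (h ∘ (0F ∷_))))
                 (∑-weak-after-1 s (h ∘ (1F ∷_))) ⟩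
  antidiagonal s (λ i j → h (0F ∷ replicate i 0F ++ replicate j 1F)) + h (replicate (suc s) 1F)
    ≡⟨ +-comm _ (h (replicate (suc s) 1F)) ⟩
  antidiagonal (suc s) (λ i j → h (replicate i 0F ++ replicate j 1F)) ∎
  where open ≡-Reasoning

-- Reading 0F as a step up and 1F as a step down, the walk that starts at
-- height d stays nonnegative and ends at 0.
descends : ℕ → Word → Bool
descends zero    []       = true
descends (suc _) []       = false
descends d       (0F ∷ w) = descends (suc d) w
descends zero    (1F ∷ w) = false
descends (suc d) (1F ∷ w) = descends d w

descends-0s : ∀ i d w → descends d (replicate i 0F ++ w) ≡ descends (d + i) w
descends-0s zero    d w = cong (λ e → descends e w) (sym (+-identityʳ d))
descends-0s (suc i) d w = begin
  descends d (0F ∷ replicate i 0F ++ w)  ≡⟨ descends-0∷ d ⟩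
  descends (suc d) (replicate i 0F ++ w) ≡⟨ descends-0s i (suc d) w ⟩
  descends (suc d + i) w                 ≡⟨ cong (λ e → descends e w) (+-suc d i) ⟨
  descends (d + suc i) w                 ∎
  where
  open ≡-Reasoning
  descends-0∷ : ∀ d {w} → descends d (0F ∷ w) ≡ descends (suc d) w
  descends-0∷ zero    = refl
  descends-0∷ (suc d) = refl

allWeak? : (us : List Word) → Dec (All (Linked Fin._≤_) us)
allWeak? = All.all? weak?

replicate-∷ʳ : ∀ n (x : A) → replicate n x ++ [ x ] ≡ x ∷ replicate n x
replicate-∷ʳ zero    x = refl
replicate-∷ʳ (suc n) x = cong (x ∷_) (replicate-∷ʳ n x)

reverse-replicate : ∀ n (x : A) → reverse (replicate n x) ≡ replicate n x
reverse-replicate zero    x = refl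
reverse-replicate (suc n) x = begin
  reverse (x ∷ replicate n x)      ≡⟨ unfold-reverse x (replicate n x) ⟩
  reverse (replicate n x) ++ [ x ] ≡⟨ cong (_++ [ x ]) (reverse-replicate n x) ⟩
  replicate n x ++ [ x ]           ≡⟨ replicate-∷ʳ n x ⟩
  x ∷ replicate n x                ∎
  where open ≡-Reasoning

-- A weakly increasing row read from right to left goes down j steps first, which requires j ≤ d,
-- and then up i steps: exactly one term of the recursion of `paths`. The starting height d is
-- general so that the induction on the rows goes through.
paths-words : ∀ s m d →
  ∑ (choices (replicate m (words s)))
    (λ us → χ (does (allWeak? us) ∧ descends d (concatMap reverse us)))
  ≡ paths s m d
paths-words s zero    zero    = refl
paths-words s zero    (suc d) = refl
paths-words s (suc m) d       = begin
  ∑ (choices (replicate (suc m) (words s)))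
    (λ us → χ (does (allWeak? us) ∧ descends d (concatMap reverse us)))
    ≡⟨ ∑-cartesianProductWith _∷_ (words s) uss _ ⟩
  ∑ (words s) (λ u → ∑ uss λ us →
    χ ((does (weak? u) ∧ does (allWeak? us)) ∧ descends d (reverse u ++ concatMap reverse us)))
    ≡⟨ ∑-cong (words s) (λ u →
         trans (∑-cong uss λ us → factor (does (weak? u)) _ _) (∑-*ˡ (χ (does (weak? u))) uss _)) ⟩
  ∑ (words s) (λ u → χ (does (weak? u)) * count d (reverse u))
    ≡⟨ ∑-weak s (count d ∘ reverse) ⟩
  antidiagonal s (λ i j → count d (reverse (replicate i 0F ++ replicate j 1F)))
    ≡⟨ antidiagonal-cong s (λ i j _ → trans (cong (count d) (reverse-weak i j)) (count-after i j d)) ⟩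
  paths s (suc m) d ∎
  where
  open ≡-Reasoning
  uss = choices (replicate m (words s))
  count : ℕ → Word → ℕ
  -- `v` is the unread rest of the current row, consumed letter by letter in `count-after`.
  count d v = ∑ uss λ us → χ (does (allWeak? us) ∧ descends d (v ++ concatMap reverse us))
  factor : ∀ a b c → χ ((a ∧ b) ∧ c) ≡ χ a * χ (b ∧ c)
  factor false b c = refl
  factor true  b c = sym (+-identityʳ _)
  reverse-weak : ∀ i j →
    reverse (replicate i 0F ++ replicate j 1F) ≡ replicate j 1F ++ replicate i (Fin.zero {1})
  reverse-weak i j = trans (reverse-++ (replicate i 0F) (replicate j 1F))
    (cong₂ _++_ (reverse-replicate j 1F) (reverse-replicate i 0F))
  count-after : ∀ i j d →
    count d (replicate j 1F ++ replicate i 0F) ≡ after j d (λ e → paths s m (e + i))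
  count-after i zero d = trans
    (∑-cong uss λ us → cong (λ b → χ (does (allWeak? us) ∧ b)) (descends-0s i d (concatMap reverse us)))
    (paths-words s m (d + i))
  count-after i (suc j) zero    = ∑-zero uss λ us → cong χ (∧-zeroʳ (does (allWeak? us)))
  count-after i (suc j) (suc d) = count-after i j d

-- Fillings of the skew shape

-- Here m counts the rows below: the row above m others has s * suc m cells, of which the first s *
-- m lie in μ.
row : (s m : ℕ) → Word → List (Maybe (Fin 2))
row s m u = replicate (s * m) nothing ++ map just u

stack : (s : ℕ) → List Word → Filling 2
stack s []       = []
stack s (u ∷ us) = row s (length us) u ∷ stack s us

rowFillings-row : ∀ s m → rowFillings 2 (s * m) (s * suc m) ≡ map (row s m) (words s)
rowFillings-row s m = begin
  choices (replicate (s * m) [ nothing ] ++ replicate (s * suc m ∸ s * m) (map just (allFin 2)))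
    ≡⟨ cong (λ k → choices (replicate (s * m) [ nothing ] ++ replicate k (map just (allFin 2)))) width ⟩
  choices (replicate (s * m) [ nothing ] ++ replicate s (map just (allFin 2)))
    ≡⟨ choices-prefix nothing (s * m) _ ⟩
  map (replicate (s * m) nothing ++_) (choices (replicate s (map just (allFin 2))))
    ≡⟨ cong (map (replicate (s * m) nothing ++_)) (choices-map just (allFin 2) s) ⟩
  map (replicate (s * m) nothing ++_) (map (map just) (words s))
    ≡⟨ map-∘ (words s) ⟨
  map (row s m) (words s) ∎
  where
  open ≡-Reasoning
  width : s * suc m ∸ s * m ≡ s
  width = trans (cong (_∸ s * m) (*-suc s m)) (m+n∸n≡m s (s * m))

module _ (s : ℕ) where

  scaledStaircase : ℕ → List ℕ
  scaledStaircase m = map (s *_) (applyDownFrom suc m)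

  part-mono : ∀ m i → part (scaledStaircase m) i ≤ part (scaledStaircase (suc m)) i
  part-mono zero    i       = z≤n
  part-mono (suc m) zero    = *-monoʳ-≤ s (n≤1+n (suc m))
  part-mono (suc m) (suc i) = part-mono m i

  part-0 : ∀ m → part (scaledStaircase m) 0 ≡ s * m
  -- The bottom row of κ lies beyond the last part of μ, where `part` takes its default 0.
  part-0 zero    = sym (*-zeroʳ s)
  part-0 (suc m) = refl

  rows : ℕ → ℕ → List (List (Maybe (Fin 2)))
  rows m i = rowFillings 2 (part (scaledStaircase m) i) (part (scaledStaircase (suc m)) i)

  rows-0 : ∀ m → rows m 0 ≡ map (row s m) (words s)
  rows-0 m = trans (cong (λ k → rowFillings 2 k (s * suc m)) (part-0 m)) (rowFillings-row s m)

  -- `stack` reads the indentation of a row off the number of rows below it, hence the condition on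
  -- lengths.
  stack-∷ : ∀ m {uss xss} → xss ≡ map (row s m) (words s) → All (λ us → length us ≡ m) uss →
    cartesianProductWith _∷_ xss (map (stack s) uss)
      ≡ map (stack s) (cartesianProductWith _∷_ (words s) uss)
  stack-∷ m {uss} refl lengths = go (words s)
    where
    open ≡-Reasoning
    push : ∀ u {uss} → All (λ us → length us ≡ m) uss →
      map (row s m u ∷_) (map (stack s) uss) ≡ map (stack s) (map (u ∷_) uss)
    push u []           = refl
    push u (refl ∷ eqs) = cong (_ ∷_) (push u eqs)
    go : ∀ us → cartesianProductWith _∷_ (map (row s m) us) (map (stack s) uss)
                ≡ map (stack s) (cartesianProductWith _∷_ us uss)
    go []       = refl
    go (u ∷ us) = trans (cong₂ _++_ (push u lengths) (go us)) (sym (map-++ (stack s) (map (u ∷_) uss) _))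

  -- Deleting the top row leaves the next smaller shape, and `rows (suc m) (suc i)` reduces to
  -- `rows m i`.
  choices-rows : ∀ m → choices (applyUpTo (rows m) (suc (length (scaledStaircase m))))
                       ≡ map (stack s) (choices (replicate (suc m) (words s)))
  choices-rows zero    = stack-∷ 0 (rows-0 0) (refl ∷ [])
  choices-rows (suc m) = begin
    cartesianProductWith _∷_ (rows (suc m) 0)
      (choices (applyUpTo (rows m) (suc (length (scaledStaircase m)))))
      ≡⟨ cong (cartesianProductWith _∷_ (rows (suc m) 0)) (choices-rows m) ⟩
    cartesianProductWith _∷_ (rows (suc m) 0) (map (stack s) (choices (replicate (suc m) (words s))))
      ≡⟨ stack-∷ (suc m) (rows-0 (suc m))
           (All.map proj₁ (choices-All (All.universal (λ _ → tt) (words s)) (suc m))) ⟩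
    map (stack s) (choices (replicate (suc (suc m)) (words s))) ∎
    where open ≡-Reasoning

  fillings-stack : .{{_ : NonZero s}} → ∀ m →
    fillings 2 (s ⋆ staircase (suc m)) (s ⋆ staircase m)
      ≡ map (stack s) (choices (replicate (suc m) (words s)))
  fillings-stack m = begin
    fillings 2 κ μ
      ≡⟨ cong (if_then choices (map (rows m) (upTo (length (κ .parts)))) else []) (dec-true (μ ⊆? κ) μ⊆κ) ⟩
    choices (map (rows m) (upTo (length (κ .parts))))
      ≡⟨ cong choices (map-upTo (rows m) (length (κ .parts))) ⟩
    choices (applyUpTo (rows m) (length (κ .parts)))
      ≡⟨ choices-rows m ⟩
    map (stack s) (choices (replicate (suc m) (words s))) ∎
    where
    open ≡-Reasoning
    κ = s ⋆ staircase (suc m)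
    μ = s ⋆ staircase m
    μ⊆κ : μ ⊆ κ
    μ⊆κ = All.applyUpTo⁺₂ id (length (μ .parts)) (part-mono m)

readingWord-stack : ∀ s us → readingWord (stack s us) ≡ concatMap reverse us
readingWord-stack s []       = refl
readingWord-stack s (u ∷ us) =
  cong₂ (λ v w → reverse v ++ w) (catMaybes-row (s * length us)) (readingWord-stack s us)
  where
  catMaybes-row : ∀ k → catMaybes (replicate k nothing ++ map just u) ≡ u
  catMaybes-row zero    = go u
    where
    go : ∀ (v : Word) → catMaybes (map just v) ≡ v
    go []      = refl
    go (x ∷ v) = cong (x ∷_) (go v)
  catMaybes-row (suc k) = catMaybes-row k

-- Empty cells stand only to the left of the entries, and `Connected` allows `nothing` before
-- anything. The case of one empty cell is the border between the two.
rowWeak⁺ : ∀ k {u : Word} → Linked Fin._≤_ u → RowWeak (replicate k nothing ++ map just u)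
rowWeak⁺ zero          []        = []
rowWeak⁺ zero          [-]       = [-]
rowWeak⁺ zero          (p ∷ ps)  = just p ∷ rowWeak⁺ zero ps
rowWeak⁺ (suc zero)    []        = [-]
rowWeak⁺ (suc zero)    [-]       = nothing-just ∷ [-]
rowWeak⁺ (suc zero)    (p ∷ ps)  = nothing-just ∷ rowWeak⁺ zero (p ∷ ps)
rowWeak⁺ (suc (suc k)) ps        = nothing ∷ rowWeak⁺ (suc k) ps

rowWeak⁻ : ∀ k {u : Word} → RowWeak (replicate k nothing ++ map just u) → Linked Fin._≤_ u
rowWeak⁻ zero    {[]}        _             = []
rowWeak⁻ zero    {_ ∷ []}    _             = [-]
rowWeak⁻ zero    {_ ∷ _ ∷ _} (just p ∷ ps) = p ∷ rowWeak⁻ zero ps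
rowWeak⁻ (suc k)             ps            = rowWeak⁻ k (Linked.tail ps)

-- This is why columns impose no condition: the row below is exactly as long as the run of empty
-- cells above it (`length-row`), so it never lies under an entry.
columnStrict-nothing : ∀ k (xs ys : List (Maybe (Fin 2))) → length ys ≤ k →
  ColumnStrict (replicate k nothing ++ xs) ys
columnStrict-nothing zero    []       []             _ = []
columnStrict-nothing zero    (_ ∷ _)  []             _ = []
columnStrict-nothing (suc k) xs       []             _ = []
columnStrict-nothing (suc k) xs       (nothing ∷ ys) p = nothing ∷ columnStrict-nothing k xs ys (s≤s⁻¹ p)
columnStrict-nothing (suc k) xs       (just _ ∷ ys)  p = nothing-just ∷ columnStrict-nothing k xs ys (s≤s⁻¹ p)

module _ {s : ℕ} where

  length-row : ∀ m {u : Word} → length u ≡ s → length (row s m u) ≡ s * suc m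
  length-row m {u} p = begin
    length (row s m u)
      ≡⟨ length-++ (replicate (s * m) nothing) ⟩
    length (replicate (s * m) (nothing {A = Fin 2})) + length (map just u)
      ≡⟨ cong₂ _+_ (length-replicate (s * m)) (trans (length-map just u) p) ⟩
    s * m + s
      ≡⟨ +-comm (s * m) s ⟩
    s + s * m
      ≡⟨ *-suc s m ⟨
    s * suc m ∎
    where open ≡-Reasoning

  columnStrict-stack : ∀ {us} → All (λ u → length u ≡ s) us → Linked ColumnStrict (stack s us)
  columnStrict-stack []           = []
  columnStrict-stack (p ∷ [])     = [-]
  columnStrict-stack {u ∷ v ∷ us} (_ ∷ ps@(p ∷ _)) =
    columnStrict-nothing (s * suc (length us)) (map just u) (row s (length us) v)
      (≤-reflexive (length-row (length us) p))
    ∷ columnStrict-stack ps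

  semistandard-stack : ∀ {us} → All (λ u → length u ≡ s) us →
    Semistandard (stack s us) ⇔ All (Linked Fin._≤_) us
  semistandard-stack ps = mk⇔ (λ (weak , _) → from weak) (λ weak → to weak , columnStrict-stack ps)
    where
    to : ∀ {us} → All (Linked Fin._≤_) us → All RowWeak (stack s us)
    to []                = []
    to {u ∷ us} (q ∷ qs) = rowWeak⁺ (s * length us) q ∷ to qs
    from : ∀ {us} → All RowWeak (stack s us) → All (Linked Fin._≤_) us
    from {[]}     []       = []
    from {u ∷ us} (q ∷ qs) = rowWeak⁻ (s * length us) q ∷ from qs

  length-concatMap-reverse : ∀ {us : List Word} → All (λ u → length u ≡ s) us →
    length (concatMap reverse us) ≡ length us * s
  length-concatMap-reverse []                = refl
  length-concatMap-reverse {u ∷ us} (p ∷ ps) =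
    trans (length-++ (reverse u))
          (cong₂ _+_ (trans (length-reverse u) p) (length-concatMap-reverse ps))

-- d is the surplus of `0F` over `1F` in the letters already read.
BallotFrom : ℕ → Word → Set
BallotFrom d w = All (λ u → occurrences 1F u ≤ d + occurrences 0F u) (inits w)

descends⁺ : ∀ d w → BallotFrom d w → d + occurrences 0F w ≡ occurrences 1F w → T (descends d w)
descends⁺ zero    []       _        _  = tt
descends⁺ (suc d) []       _        ()
descends⁺ zero    (0F ∷ w) (_ ∷ bs) eq = descends⁺ 1 w (All.map⁻ bs) eq
descends⁺ (suc d) (0F ∷ w) (_ ∷ bs) eq =
  descends⁺ (2 + d) w
    (All.map (λ {u} → subst (occurrences 1F u ≤_) (cong suc (+-suc d _))) (All.map⁻ bs))
    (trans (cong suc (sym (+-suc d _))) eq)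
-- The prefix consisting of `1F` alone would need 1 ≤ 0.
descends⁺ zero    (1F ∷ w) (_ ∷ () ∷ _) _
descends⁺ (suc d) (1F ∷ w) (_ ∷ bs) eq =
  descends⁺ d w (All.map s≤s⁻¹ (All.map⁻ bs)) (suc-injective eq)

descends⁻ : ∀ d w → T (descends d w) → BallotFrom d w × d + occurrences 0F w ≡ occurrences 1F w
descends⁻ zero    []       _ = z≤n ∷ [] , refl
descends⁻ zero    (0F ∷ w) t with bs , eq ← descends⁻ 1 w t = z≤n ∷ All.map⁺ bs , eq
descends⁻ (suc d) (0F ∷ w) t with bs , eq ← descends⁻ (2 + d) w t =
  z≤n ∷ All.map⁺ (All.map (λ {u} → subst (occurrences 1F u ≤_) (cong suc (sym (+-suc d _)))) bs)
  , trans (cong suc (+-suc d _)) eq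
descends⁻ zero    (1F ∷ w) ()
descends⁻ (suc d) (1F ∷ w) t with bs , eq ← descends⁻ d w t =
  z≤n ∷ All.map⁺ (All.map s≤s bs) , cong suc eq

occurrences-sum : ∀ (w : Word) → occurrences 0F w + occurrences 1F w ≡ length w
occurrences-sum []       = refl
occurrences-sum (0F ∷ w) = cong suc (occurrences-sum w)
occurrences-sum (1F ∷ w) = trans (+-suc (occurrences 0F w) _) (cong suc (occurrences-sum w))

-- For length 2k, content (k, k) amounts to equal numbers of both letters, so the walk ends at 0.
-- The only pair a < b in `Fin 2` is `0F`, `1F`, so being ballot means staying nonnegative.
descends-ballot : ∀ k w → length w ≡ k + k →
  (HasContent (k ∷ k ∷ []) w × Ballot w) ⇔ T (descends 0 w)
descends-ballot k w len = mk⇔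
  (λ (content , ballot) → descends⁺ 0 w (All.map (λ b → b 0F 1F (s≤s z≤n)) ballot)
                                        (trans (content 0F) (sym (content 1F))))
  λ t → let bs , eq = descends⁻ 0 w t in content eq , All.map (λ {u} → pairs {u}) bs
  where
  half : ∀ a b → a + a ≡ b + b → a ≡ b
  half a b eq = *-cancelˡ-≡ a b 2 (trans (double a) (trans eq (sym (double b))))
    where
    double : ∀ a → 2 * a ≡ a + a
    double = ℕ-solver.solve-∀
  content : occurrences 0F w ≡ occurrences 1F w → HasContent (k ∷ k ∷ []) w
  content eq 0F = half _ k (trans (cong (_+_ (occurrences 0F w)) eq) (trans (occurrences-sum w) len))
  content eq 1F = trans (sym eq) (content eq 0F)
  pairs : ∀ {u : Word} → occurrences 1F u ≤ occurrences 0F u →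
    ∀ a b → a Fin.< b → occurrences b u ≤ occurrences a u
  pairs b 0F 1F _        = b
  pairs b 0F 0F ()
  pairs b 1F 0F ()
  pairs b 1F 1F (s≤s ())

-- Counting the Littlewood-Richardson fillings

module _ (s n : ℕ) .{{_ : NonZero s}} .{{_ : NonZero n}} where

  isLR-stack : ∀ {us} → length us ≡ 2 * n × All (λ u → length u ≡ s) us →
    χ (does (isLittlewoodRichardson? (s ⋆ twoRows n) (stack s us)))
      ≡ χ (does (allWeak? us) ∧ descends 0 (concatMap reverse us))
  isLR-stack {us} (len , lens) = cong χ (does-⇔ equivalence
    (isLittlewoodRichardson? (s ⋆ twoRows n) (stack s us))
    -- `does` of this decision computes to the conjunction of booleans counted by `paths-words`.
    (allWeak? us ×-dec T? (descends 0 (concatMap reverse us))))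
    where
    w = concatMap reverse us
    length-w : length w ≡ s * n + s * n
    length-w = trans (length-concatMap-reverse lens) (trans (cong (_* s) len) (arg s n))
      where
      arg : ∀ s n → 2 * n * s ≡ s * n + s * n
      arg = ℕ-solver.solve-∀
    module S = Equivalence (semistandard-stack lens)
    module D = Equivalence (descends-ballot (s * n) w length-w)
    reading : readingWord (stack s us) ≡ w
    reading = readingWord-stack s us
    equivalence : IsLittlewoodRichardson (s ⋆ twoRows n) (stack s us)
                  ⇔ (All (Linked Fin._≤_) us × T (descends 0 w))
    equivalence = mk⇔
      (λ (ss , content , ballot) → S.to ss ,
         D.to (subst (HasContent (s * n ∷ s * n ∷ [])) reading content , subst Ballot reading ballot))
      (λ (weak , t) → let content , ballot = D.from t in S.from weak ,
         subst (HasContent (s * n ∷ s * n ∷ [])) (sym reading) content , subst Ballot (sym reading) ballot)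

  -- The shape has `suc m` rows; that this is 2n makes its size agree with that of the content (sn,
  -- sn).
  littlewoodRichardson-paths : ∀ m → suc m ≡ 2 * n →
    littlewoodRichardson (s ⋆ staircase (suc m)) (s ⋆ staircase m) (s ⋆ twoRows n) ≡ paths s (suc m) 0
  littlewoodRichardson-paths m eq = begin
    length (filter isLR? (fillings 2 (s ⋆ staircase (suc m)) (s ⋆ staircase m)))
      ≡⟨ cong (length ∘ filter isLR?) (fillings-stack s m) ⟩
    length (filter isLR? (map (stack s) uss))
      ≡⟨ length-filter-∑ isLR? (map (stack s) uss) ⟩
    ∑ (map (stack s) uss) (χ ∘ does ∘ isLR?)
      ≡⟨ ∑-map (stack s) uss _ ⟩
    ∑ uss (χ ∘ does ∘ isLR? ∘ stack s)
      ≡⟨ ∑-cong-All (All.map (λ (len , ps) → isLR-stack (trans len eq , All.map proj₁ ps))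
           (choices-All (choices-All (All.universal (λ _ → tt) (allFin 2)) s) (suc m))) ⟩
    ∑ uss (λ us → χ (does (allWeak? us) ∧ descends 0 (concatMap reverse us)))
      ≡⟨ paths-words s (suc m) 0 ⟩
    paths s (suc m) 0 ∎
    where
    open ≡-Reasoning
    isLR? = isLittlewoodRichardson? (s ⋆ twoRows n)
    uss = choices (replicate (suc m) (words s))

theorem2 : (s n : ℕ) .{{_ : NonZero s}} .{{_ : NonZero n}} →
    + littlewoodRichardson (s ⋆ staircase (2 * n)) (s ⋆ staircase (2 * n ∸ 1)) (s ⋆ twoRows n)
    ≡ + binomial s (2 * n) (s * n) - + binomial s (2 * n) (s * n + 1)
theorem2 s n@(suc n-1) = begin
  + littlewoodRichardson (s ⋆ staircase (2 * n)) (s ⋆ staircase (2 * n ∸ 1)) (s ⋆ twoRows n)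
    -- Since n is matched as a successor, `suc (2 * n ∸ 1)` computes to `2 * n`.
    ≡⟨ cong +_ (littlewoodRichardson-paths s n (2 * n ∸ 1) refl) ⟩
  + paths s (2 * n) 0
    ≡⟨ cancel (+ paths s (2 * n) 0) (+ b₁) ⟩
  + (paths s (2 * n) 0 + b₁) - + b₁
    ≡⟨ cong (λ b → + b - + b₁) (paths-binomial s n) ⟩
  + binomial s (2 * n) (s * n) - + b₁ ∎
  where
  open ≡-Reasoning
  b₁ = binomial s (2 * n) (s * n + 1)
  cancel : ∀ a b → a ≡ a ℤ.+ b - b
  cancel = ℤ-solver.solve-∀
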